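{- Let $G=(V,E)$ be a finite simple undirected graph, let $V_C\subseteq V$ be non-empty, let $C=(V_C,E_C)$ be the subgraph of $G$ induced by $V_C$ (the core), and let $P=(V_P,E_P)$ be the graph obtained from $G$ by contracting $C$ into one vertex (the periphery), where $E_P$ is identified with $E\setminus E_C$. Assume that $P$ is a tree. Let $A$ and $B$ be disjoint sets, let $e\mapsto[e]_C\subseteq A$ be a labelling of the edges $e \in E_C$ of $C$, and let $e\mapsto[e]_P\subseteq B$ be a labelling of the edges $e\in E_P$ of $P$. Assume that for every shortest path in $C$ the labelling $[\cdot]_C$ has no false positives in $E_C$, and that for every shortest path in $P$ the labelling $[\cdot]_P$ has no false positives in $E_P$. Define the combined labelling of the edges of $G$, with universal set $A\cup B$, by $[e]=[e]_C$ if $e\in E_C$ and $[e]=[e]_P$ if $e\in E_P$. Then for every shortest path in $G$, with edge set $S$, the combined labelling has no false positives; that is, there is no edge $f\in E$ with $f\notin S$ and $[f]\subseteq[S]$.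
   Context: A labelling of the edges of a graph with edge set $E$ and universal set $U$ assigns to each edge $e\in E$ a subset $[e]\subseteq U$; for $S\subseteq E$ one puts $[S]=\bigcup_{e\in S}[e]$ (so $[\emptyset]=\emptyset$). A false positive for $S\subseteq E$ is an edge $f\in E$ such that $f\notin S$ but $[f]\subseteq[S]$. A shortest path from $u$ to $v$ in a graph is a path from $u$ to $v$ in that graph with the minimum possible number of edges; it is identified with its set of edges, and paths with $0$ edges are allowed (as shortest paths from a vertex to itself). Contracting $C$ into one vertex means: all vertices of $V_C$ are replaced by a single new vertex $c$, so $V_P=(V\setminus V_C)\cup\{c\}$; the edges in $E_C$ are removed; and every other edge of $G$ is kept, with each end vertex lying in $V_C$ replaced by $c$. Thus the edges of $P$ correspond one-to-one to $E\setminus E_C$; parallel edges are kept as distinct edges, so the assumption that $P$ is a tree implies in particular that $P$ has no parallel edges. -}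

module Defs where

open import Level using (Level; suc; _⊔_)
open import Data.Nat.Base using (ℕ; _≤_)
open import Data.Fin.Base using (Fin)
open import Data.Fin.Subset as Subset using (Subset)
open import Data.Fin.Subset.Properties using (_∈?_)
open import Data.Irrelevant using ([_])
open import Data.List.Base using (List; []; _∷_; length; drop)
import Data.List.Membership.Propositional as List
open import Data.List.Relation.Unary.Unique.Propositional using (Unique)
open import Data.Product.Base using (∃; _×_; _,_; proj₁; proj₂)
open import Data.Refinement.Base using (Refinement-syntax; _,_)
open import Data.Sum.Base using (_⊎_; inj₁; inj₂)
open import Relation.Binary.PropositionalEquality.Core using (_≡_; _≢_)
open import Relation.Nullary.Decidable.Core using (Dec; yes; no; _×-dec_)
open import Relation.Nullary.Negation.Core using (¬_)
open import Relation.Unary using (Pred; _∈_; _∉_; _⊆_; _∪_)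

private
  variable
    a ℓ : Level

-- Undirected multigraphs: parallel edges are distinct elements of Edge, and
-- the order of the two ends of an edge is ignored by Joins.
record Graph : Set₁ where
  field
    Vertex : Set
    Edge   : Set
    ends   : Edge → Vertex × Vertex

  Joins : Edge → Vertex → Vertex → Set
  Joins e u v = (ends e ≡ (u , v)) ⊎ (ends e ≡ (v , u))

  infixr 5 _∷⟨_⟩_

  data Walk : Vertex → Vertex → Set where
    []     : ∀ {u} → Walk u u
    _∷⟨_⟩_ : ∀ {u v w} (e : Edge) → Joins e u v → Walk v w → Walk u w

  edges : ∀ {u v} → Walk u v → List Edge
  edges []           = []
  edges (e ∷⟨ _ ⟩ p) = e ∷ edges p

  vertices : ∀ {u v} → Walk u v → List Vertex
  vertices {u} []           = u ∷ []
  vertices {u} (_ ∷⟨ _ ⟩ p) = u ∷ vertices p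

  edgeSet : ∀ {u v} → Walk u v → Pred Edge _
  edgeSet p e = e List.∈ edges p

  size : ∀ {u v} → Walk u v → ℕ
  size p = length (edges p)

  IsPath : ∀ {u v} → Walk u v → Set
  IsPath p = Unique (vertices p)

  IsShortestPath : ∀ {u v} → Walk u v → Set
  IsShortestPath {u} {v} p =
    IsPath p × (∀ (q : Walk u v) → IsPath q → size p ≤ size q)

  -- Loops and pairs of parallel edges are cycles of size 1 and 2; requiring
  -- distinct edges excludes going back and forth along a single edge.
  IsCycle : ∀ {u} → Walk u u → Set
  IsCycle p = 1 ≤ size p × Unique (edges p) × Unique (drop 1 (vertices p))

  record IsTree : Set where
    field
      nonEmpty  : Vertex
      connected : ∀ u v → ∃ λ (p : Walk u v) → IsPath p
      acyclic   : ∀ {u} (p : Walk u u) → ¬ IsCycle p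

record FiniteSimpleGraph : Set where
  field
    #V #E : ℕ
    ends  : Fin #E → Fin #V × Fin #V

  graph : Graph
  graph = record { Vertex = Fin #V ; Edge = Fin #E ; ends = ends }

  open Graph graph public using (Joins)

  field
    loopless   : ∀ e → proj₁ (ends e) ≢ proj₂ (ends e)
    noParallel : ∀ {e f u v} → Joins e u v → Joins f u v → e ≡ f

module CorePeriphery (G : FiniteSimpleGraph)
                     (V-C : Subset (FiniteSimpleGraph.#V G)) where
  open FiniteSimpleGraph G

  InCore : Fin #E → Set
  InCore e = proj₁ (ends e) Subset.∈ V-C × proj₂ (ends e) Subset.∈ V-C

  inCore? : ∀ e → Dec (InCore e)
  inCore? e = (proj₁ (ends e) ∈? V-C) ×-dec (proj₂ (ends e) ∈? V-C)

  core : Graph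
  core = record
    { Vertex = [ v ∈ Fin #V ∣ v Subset.∈ V-C ]
    ; Edge   = [ e ∈ Fin #E ∣ InCore e ]
    ; ends   = λ { (e , [ e∈ ]) → (proj₁ (ends e) , [ proj₁ e∈ ])
                                , (proj₂ (ends e) , [ proj₂ e∈ ]) }
    }

  data V-P : Set where
    c       : V-P
    outside : [ v ∈ Fin #V ∣ v Subset.∉ V-C ] → V-P

  contract : Fin #V → V-P
  contract v with v ∈? V-C
  ... | yes _  = c
  ... | no v∉ = outside (v , [ v∉ ])

  periphery : Graph
  periphery = record
    { Vertex = V-P
    ; Edge   = [ e ∈ Fin #E ∣ ¬ InCore e ]
    ; ends   = λ { (e , _) → contract (proj₁ (ends e))
                           , contract (proj₂ (ends e)) }
    }

record Labelling (G : Graph) {U : Set a} (X : Pred U ℓ) : Set (a ⊔ suc ℓ) where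
  open Graph G
  field
    label  : Edge → Pred U ℓ
    within : ∀ e → label e ⊆ X

  labels : Pred Edge Level.zero → Pred U ℓ
  labels S x = ∃ λ e → e ∈ S × x ∈ label e

  FalsePositive : Pred Edge Level.zero → Edge → Set (a ⊔ ℓ)
  FalsePositive S f = f ∉ S × label f ⊆ labels S

  NoFalsePositives : Pred Edge Level.zero → Set (a ⊔ ℓ)
  NoFalsePositives S = ¬ ∃ λ f → FalsePositive S f

  NoFalsePositivesOnShortestPaths : Set (a ⊔ ℓ)
  NoFalsePositivesOnShortestPaths =
    ∀ {u v} (p : Walk u v) → IsShortestPath p → NoFalsePositives (edgeSet p)

module _ (G : FiniteSimpleGraph) (V-C : Subset (FiniteSimpleGraph.#V G))
         {U : Set a} {A B : Pred U ℓ} where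
  open FiniteSimpleGraph G using (graph; #E)
  open CorePeriphery G V-C
  open Labelling

  combined : Labelling core A → Labelling periphery B → Labelling graph (A ∪ B)
  combined L-C L-P = record { label = lab ; within = within′ }
    where
    lab : Fin #E → Pred U ℓ
    lab e with inCore? e
    ... | yes e∈ = label L-C (e , [ e∈ ])
    ... | no  e∉ = label L-P (e , [ e∉ ])

    within′ : ∀ e → lab e ⊆ (A ∪ B)
    within′ e with inCore? e
    ... | yes e∈ = λ x∈ → inj₁ (within L-C (e , [ e∈ ]) x∈)
    ... | no  e∉ = λ x∈ → inj₂ (within L-P (e , [ e∉ ]) x∈)

{-# OPTIONS --safe #-}
-- Since P is a tree, a trail of G that starts and ends in the core never
-- leaves it: the edges outside the core would form a closed trail of P.  So a
-- shortest path p of G meets C in a single path, which is shortest in C because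
-- a shorter detour in C would shorten p; and the remaining edges of p form a
-- trail of P, which is a shortest path because paths in a tree are unique: after
-- a common initial part, reversing one and following the other is a closed walk
-- without backtracking, which contains a cycle.  As A and B are disjoint, a false
-- positive for p in C or in P is a false positive for that part of p.
module Submission where

open import Defs
import Data.Fin.Properties as Fin
open import Data.Fin.Subset as Subset using (Subset; Nonempty)
open import Data.Fin.Subset.Properties using (_∈?_)
open import Data.Irrelevant using ([_])
open import Data.List.Base as List using (List; []; _∷_; map; take; filter; length)
open import Data.List.Membership.Propositional using (_∈_; _∉_)
open import Data.List.Membership.Propositional.Properties
  using (∈-map⁺; ∈-map⁻; ∈-++⁺ˡ; ∈-++⁺ʳ; ∈-++⁻; ∈-filter⁺; ∈-filter⁻)
open import Data.List.Properties using (filter-accept; filter-reject; length-map; length-++)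
open import Data.List.Relation.Unary.All using ([]; _∷_)
open import Data.List.Relation.Unary.All.Properties using (¬Any⇒All¬; All¬⇒¬Any)
open import Data.List.Relation.Unary.AllPairs using ([]; _∷_)
open import Data.List.Relation.Unary.Any using (here; there)
open import Data.List.Relation.Unary.Linked as Linked using (Linked; _∷_)
open import Data.List.Relation.Unary.Linked.Properties using (AllPairs⇒Linked)
open import Data.List.Relation.Unary.Unique.Propositional using (Unique)
import Data.List.Relation.Unary.Unique.Propositional.Properties as Unique
open import Data.Nat.Base using (suc; _+_; _≤_; z≤n; s≤s)
open import Data.Nat.Properties
  using (≤-refl; ≤-reflexive; ≤-trans; m≤n⇒m≤1+n; +-suc; +-cancelˡ-≤; +-cancelʳ-≤;
        module ≤-Reasoning)
open import Data.Product.Base as Product using (∃; ∃-syntax; _×_; _,_; proj₁; proj₂)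
open import Data.Refinement.Base using (value; _,_)
import Data.Refinement.Properties as Refinement
open import Data.Sum.Base as Sum using (_⊎_; inj₁; inj₂)
open import Function.Base using (_∘_)
open import Relation.Binary.Definitions using (DecidableEquality)
open import Relation.Binary.PropositionalEquality.Core
  using (_≡_; _≢_; refl; sym; trans; cong; subst; ≢-sym)
open import Relation.Nullary.Decidable.Core using (yes; no; ¬?)
open import Relation.Nullary.Negation.Core using (¬_; contradiction)
open import Relation.Unary using (Pred; _⊥_; _∪_) renaming (_∈_ to _∈ᴾ_)
open FiniteSimpleGraph using (#V)
open CorePeriphery using (core; periphery)
open Graph using (IsTree)
open Labelling using (NoFalsePositivesOnShortestPaths)

-- Walks, trails and paths in a multigraph.

module Walks (G : Graph) where
  open Graph G

  private
    variable
      u v w x : Vertex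
      e : Edge

  IsTrail IsReduced : Walk u v → Set
  IsTrail p   = Unique (edges p)
  IsReduced p = Linked _≢_ (edges p)

  Joins-sym : Joins e u v → Joins e v u
  Joins-sym = Sum.swap

  Joins-end : Joins e u v → Joins e x w → u ≡ x ⊎ u ≡ w
  Joins-end (inj₁ eq) (inj₁ eq′) = inj₁ (cong proj₁ (trans (sym eq) eq′))
  Joins-end (inj₁ eq) (inj₂ eq′) = inj₂ (cong proj₁ (trans (sym eq) eq′))
  Joins-end (inj₂ eq) (inj₁ eq′) = inj₂ (cong proj₂ (trans (sym eq) eq′))
  Joins-end (inj₂ eq) (inj₂ eq′) = inj₁ (cong proj₂ (trans (sym eq) eq′))

  Joins-functional : Joins e u v → Joins e u w → v ≡ w
  Joins-functional j k with Joins-end (Joins-sym j) k | Joins-end (Joins-sym k) j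
  ... | inj₂ v≡w | _        = v≡w
  ... | inj₁ _   | inj₂ w≡v = sym w≡v
  ... | inj₁ v≡u | inj₁ w≡u = trans v≡u (sym w≡u)

  start∈vertices : (p : Walk u v) → u ∈ vertices p
  start∈vertices []           = here refl
  start∈vertices (_ ∷⟨ _ ⟩ _) = here refl

  end∈vertices : (p : Walk u v) → v ∈ vertices p
  end∈vertices []           = here refl
  end∈vertices (_ ∷⟨ _ ⟩ p) = there (end∈vertices p)

  edge-end∈vertices : (p : Walk u v) → e ∈ edges p → Joins e w x → w ∈ vertices p
  edge-end∈vertices (_ ∷⟨ j ⟩ p) (here refl) k with Joins-end k j
  ... | inj₁ refl = here refl
  ... | inj₂ refl = there (start∈vertices p)
  edge-end∈vertices (_ ∷⟨ _ ⟩ p) (there e∈p) k = there (edge-end∈vertices p e∈p k)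

  -- If the first edge recurred later, both its ends would lie on the rest of the walk, so the start
  -- would be visited twice.
  path⇒trail : (p : Walk u v) → IsPath p → IsTrail p
  path⇒trail []           _             = []
  path⇒trail (_ ∷⟨ j ⟩ p) (u∉p ∷ p-path) =
    ¬Any⇒All¬ _ (λ e∈p → All¬⇒¬Any u∉p (edge-end∈vertices p e∈p j)) ∷ path⇒trail p p-path

  closed-path-empty : (p : Walk u u) → IsPath p → edges p ≡ []
  closed-path-empty []           _         = refl
  closed-path-empty (_ ∷⟨ _ ⟩ p) (u∉p ∷ _) =
    contradiction (end∈vertices p) (All¬⇒¬Any u∉p)

  -- Describing both lists by `take` lets distinctness of edges and of vertices pass to the initial
  -- part; `n` edges go with `suc n` vertices.
  prefix : (p : Walk u v) → w ∈ vertices p →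
           ∃[ n ] ∃ λ (q : Walk u w) →
             edges q ≡ take n (edges p) × vertices q ≡ take (suc n) (vertices p)
  prefix []           (here refl) = 0 , [] , refl , refl
  prefix (e ∷⟨ j ⟩ p) (here refl) = 0 , [] , refl , refl
  prefix (e ∷⟨ j ⟩ p) (there w∈p) =
    let n , q , es , vs = prefix p w∈p
    in suc n , e ∷⟨ j ⟩ q , cong (e ∷_) es , cong (_ ∷_) vs

  suffix : (p : Walk u v) → IsPath p → w ∈ vertices p →
           ∃ λ (q : Walk w v) → IsPath q × size q ≤ size p
  suffix p@[]           p-path       (here refl) = p , p-path , ≤-refl
  suffix p@(_ ∷⟨ _ ⟩ _) p-path       (here refl) = p , p-path , ≤-refl
  suffix (_ ∷⟨ _ ⟩ p)   (_ ∷ p-path) (there w∈p) =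
    let q , q-path , q≤p = suffix p p-path w∈p in q , q-path , m≤n⇒m≤1+n q≤p

  module _ (_≟_ : DecidableEquality Vertex) where
    open import Data.List.Membership.DecPropositional _≟_ using () renaming (_∈?_ to _∈ᴸ?_)

    -- Minimality is stated against paths only; erasing detours makes it applicable to arbitrary
    -- walks. If the start recurs on the path found for the rest, that path is cut to begin there.
    shorten : (p : Walk u v) → ∃ λ (q : Walk u v) → IsPath q × size q ≤ size p
    shorten []               = [] , [] ∷ [] , z≤n
    shorten {u} (e ∷⟨ j ⟩ p) with shorten p
    ... | q , q-path , q≤p with u ∈ᴸ? vertices q
    ...   | no  u∉q = e ∷⟨ j ⟩ q , ¬Any⇒All¬ _ u∉q ∷ q-path , s≤s q≤p
    ...   | yes u∈q =
      let r , r-path , r≤q = suffix q q-path u∈q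
      in r , r-path , m≤n⇒m≤1+n (≤-trans r≤q q≤p)

  -- Concatenation and reversal.

  infixr 5 _++_
  _++_ : Walk u v → Walk v w → Walk u w
  []           ++ q = q
  (e ∷⟨ j ⟩ p) ++ q = e ∷⟨ j ⟩ (p ++ q)

  ++-edges : (p : Walk u v) (q : Walk v w) → edges (p ++ q) ≡ edges p List.++ edges q
  ++-edges []           q = refl
  ++-edges (e ∷⟨ _ ⟩ p) q = cong (e ∷_) (++-edges p q)

  ++-size : (p : Walk u v) (q : Walk v w) → size (p ++ q) ≡ size p + size q
  ++-size p q = trans (cong length (++-edges p q)) (length-++ (edges p))

  vertices-++ˡ : (p : Walk u v) (q : Walk v w) → x ∈ vertices p → x ∈ vertices (p ++ q)
  vertices-++ˡ []           q (here refl)  = start∈vertices q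
  vertices-++ˡ (_ ∷⟨ _ ⟩ _) q (here refl)  = here refl
  vertices-++ˡ (_ ∷⟨ _ ⟩ p) q (there x∈p) = there (vertices-++ˡ p q x∈p)

  ++-pathˡ : (p : Walk u v) {q : Walk v w} → IsPath (p ++ q) → IsPath p
  ++-pathˡ []           _               = [] ∷ []
  ++-pathˡ (_ ∷⟨ _ ⟩ p) (u∉pq ∷ pq-path) =
    ¬Any⇒All¬ _ (All¬⇒¬Any u∉pq ∘ vertices-++ˡ p _) ∷ ++-pathˡ p pq-path

  ++-pathʳ : (p : Walk u v) {q : Walk v w} → IsPath (p ++ q) → IsPath q
  ++-pathʳ []           q-path        = q-path
  ++-pathʳ (_ ∷⟨ _ ⟩ p) (_ ∷ pq-path) = ++-pathʳ p pq-path

  rewind : Walk u v → Walk u w → Walk v w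
  rewind []           q = q
  rewind (e ∷⟨ j ⟩ p) q = rewind p (e ∷⟨ Joins-sym j ⟩ q)

  rewind-size : (p : Walk u v) (q : Walk u w) → size (rewind p q) ≡ size p + size q
  rewind-size []           q = refl
  rewind-size (_ ∷⟨ _ ⟩ p) q = trans (rewind-size p _) (+-suc (size p) (size q))

  -- The invariant keeps the edge `e` moved last: that it differs from the next edge of `p` is what
  -- the new junction requires.
  rewind-reduced : (p : Walk u v) {j : Joins e x u} (q : Walk x w) →
                   Linked _≢_ (e ∷ edges p) → IsReduced (e ∷⟨ Joins-sym j ⟩ q) →
                   IsReduced (rewind p (e ∷⟨ Joins-sym j ⟩ q))
  rewind-reduced []           q _         eq = eq
  rewind-reduced (_ ∷⟨ k ⟩ p) q (e≢f ∷ fp) eq =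
    rewind-reduced p {k} (_ ∷⟨ _ ⟩ q) fp (≢-sym e≢f ∷ eq)

  -- Uniqueness of paths in acyclic graphs.

  module Acyclic (acyclic : ∀ {u} (p : Walk u u) → ¬ IsCycle p) where

    -- In a path starting at v, an edge at v can only be the first edge.
    reduced-cons-trail : Joins e u v → (p : Walk v w) → IsPath p →
                         Linked _≢_ (e ∷ edges p) → Unique (e ∷ edges p)
    reduced-cons-trail {e} j p p-path lk = ¬Any⇒All¬ _ (e∉ p p-path lk) ∷ path⇒trail p p-path
      where
      e∉ : (p : Walk _ _) → IsPath p → Linked _≢_ (e ∷ edges p) → e ∉ edges p
      e∉ (_ ∷⟨ _ ⟩ p) _         (e≢f ∷ _) (here e≡f)  = e≢f e≡f
      e∉ (_ ∷⟨ _ ⟩ p) (v∉p ∷ _) _         (there e∈p) =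
        All¬⇒¬Any v∉p (edge-end∈vertices p e∈p (Joins-sym j))

    -- By induction the tail is a path. If the start recurred on it, the first edge and the tail up
    -- to that vertex would form a cycle.
    reduced⇒path : (p : Walk u v) → IsReduced p → IsPath p
    reduced⇒path []           _  = [] ∷ []
    reduced⇒path (e ∷⟨ j ⟩ p) lk = ¬Any⇒All¬ _ u∉p ∷ p-path
      where
      p-path : IsPath p
      p-path = reduced⇒path p (Linked.tail lk)

      u∉p : _ ∉ vertices p
      u∉p u∈p =
        -- If `n` is 0, the edge `e` alone is a loop, which counts as a cycle.
        let n , q , es , vs = prefix p u∈p
        in acyclic (e ∷⟨ j ⟩ q)
             ( s≤s z≤n
             , subst (Unique ∘ (e ∷_)) (sym es)
                 (Unique.take⁺ (suc n) (reduced-cons-trail j p p-path lk))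
             , subst Unique (sym vs) (Unique.take⁺ (suc n) p-path))

    trail⇒path : (p : Walk u v) → IsTrail p → IsPath p
    trail⇒path p = reduced⇒path p ∘ AllPairs⇒Linked

    -- Equal first edges are cancelled. If they differ, the reverse of one path followed by the
    -- other is closed and reduced, hence a path and empty, although its size is positive.
    path-size-unique : DecidableEquality Edge → (p q : Walk u v) →
                       IsPath p → IsPath q → size p ≡ size q
    path-size-unique _≟_ []  q _ q-path =
      sym (cong length (closed-path-empty q q-path))
    path-size-unique _≟_ p@(_ ∷⟨ _ ⟩ _) [] p-path _ =
      cong length (closed-path-empty p p-path)
    path-size-unique _≟_ P@(e ∷⟨ j ⟩ p) Q@(f ∷⟨ k ⟩ q) P-path@(_ ∷ p-path) Q-path@(_ ∷ q-path)
      with e ≟ f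
    ... | yes refl with refl ← Joins-functional j k =
      cong suc (path-size-unique _≟_ p q p-path q-path)
    ... | no e≢f = contradiction (trans (sym (rewind-size P Q)) (cong length closed)) λ ()
      where
      closed : edges (rewind P Q) ≡ []
      closed = closed-path-empty _ (reduced⇒path (rewind P Q)
        (rewind-reduced p {j} Q (AllPairs⇒Linked (path⇒trail P P-path))
          (e≢f ∷ AllPairs⇒Linked (path⇒trail Q Q-path))))

    trail⇒shortest : DecidableEquality Edge → (p : Walk u v) → IsTrail p → IsShortestPath p
    trail⇒shortest _≟_ p p-trail =
      trail⇒path p p-trail ,
      λ q q-path → ≤-reflexive (path-size-unique _≟_ p q (trail⇒path p p-trail) q-path)

-- Projection of walks to the periphery.

module Contraction (G : FiniteSimpleGraph) (V-C : Subset (#V G))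
                   (P-tree : IsTree (periphery G V-C)) where
  open FiniteSimpleGraph G using (graph)
  open CorePeriphery G V-C hiding (core; periphery)
  open Graph graph
  open Walks graph

  C P : Graph
  C = core G V-C
  P = periphery G V-C

  module C = Graph C
  module P = Graph P
  open Walks.Acyclic P (IsTree.acyclic P-tree) using (trail⇒path; trail⇒shortest)

  private
    variable
      u v w : Vertex
      e : Edge

  contract-core : v Subset.∈ V-C → contract v ≡ c
  contract-core {v} v∈ with v ∈? V-C
  ... | yes _  = refl
  ... | no v∉ = contradiction v∈ v∉

  core-ends : InCore e → Joins e u v → u Subset.∈ V-C × v Subset.∈ V-C
  core-ends e∈ (inj₁ refl) = e∈
  core-ends e∈ (inj₂ refl) = Product.swap e∈

  peripheral : List Edge → List Edge
  peripheral = filter (¬? ∘ inCore?)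

  -- Core edges shrink to `c` and are skipped. The equation preserves order and multiplicity of the
  -- other edges, so trails go to trails.
  collapse : (p : Walk u v) →
             ∃ λ (q : P.Walk (contract u) (contract v)) →
               map value (P.edges q) ≡ peripheral (edges p)
  collapse [] = P.[] , refl
  collapse {v = w} (e ∷⟨ j ⟩ p) with inCore? e
  -- Both ends of `e` contract to `c`, but only propositionally, so the walk for the rest has to be
  -- transported.
  ... | yes e∈ = subst (λ x → ∃ λ (q : P.Walk x (contract w)) →
                                map value (P.edges q) ≡ peripheral (e ∷ edges p))
                       (trans (contract-core (proj₂ (core-ends e∈ j)))
                              (sym (contract-core (proj₁ (core-ends e∈ j)))))
                       (let q , eq = collapse p
                        in q , trans eq (sym (filter-reject (¬? ∘ inCore?) λ e∉ → e∉ e∈)))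
  ... | no e∉ =
    let q , eq = collapse p
    in (e , [ e∉ ]) P.∷⟨ Sum.map (cong (Product.map contract contract))
                                 (cong (Product.map contract contract)) j ⟩ q
     , trans (cong (e ∷_) eq) (sym (filter-accept (¬? ∘ inCore?) e∉))

  collapse-trail : {p : Walk u v} → IsTrail p →
                   (q : P.Walk (contract u) (contract v)) →
                   map value (P.edges q) ≡ peripheral (edges p) →
                   Walks.IsTrail P q
  collapse-trail p-trail q eq =
    Unique.map⁻ (subst Unique (sym eq) (Unique.filter⁺ (¬? ∘ inCore?) p-trail))

  -- The collapsed trail is closed at `c`; in a tree it is a path, hence empty, so no edge of `p`
  -- survives the filter.
  core-trail : u Subset.∈ V-C → v Subset.∈ V-C → (p : Walk u v) → IsTrail p →
               e ∈ edges p → ¬ ¬ InCore e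
  core-trail {u} {v} {e} u∈ v∈ p p-trail e∈p e∉ =
    let q , eq = collapse p
        empty  = cong (map value) (closed q (collapse-trail {p = p} p-trail q eq))
    in contradiction (subst (e ∈_) (trans (sym eq) empty) (∈-filter⁺ (¬? ∘ inCore?) e∈p e∉)) λ ()
    where
    contract-eq : contract u ≡ contract v
    contract-eq = trans (contract-core u∈) (sym (contract-core v∈))

    closed : (q : P.Walk (contract u) (contract v)) → Walks.IsTrail P q → P.edges q ≡ []
    closed rewrite contract-eq = λ q q-trail →
      Walks.closed-path-empty P q (trail⇒path q q-trail)

  -- Core walks as walks of `G`.

  private
    variable
      a b : C.Vertex

  forget-Joins : ∀ e → C.Joins e a b → Joins (value e) (value a) (value b)
  forget-Joins _ = Sum.map (cong (Product.map value value)) (cong (Product.map value value))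

  -- The equation allows the later decompositions to be equalities of walks, incidence proofs
  -- included.
  core-Joins : (e∈ : InCore e) (j : Joins e u v) (u∈ : u Subset.∈ V-C) (v∈ : v Subset.∈ V-C) →
               ∃ λ (k : C.Joins (e , [ e∈ ]) (u , [ u∈ ]) (v , [ v∈ ])) →
                 forget-Joins (e , [ e∈ ]) k ≡ j
  core-Joins e∈ (inj₁ refl) u∈ v∈ = inj₁ refl , refl
  core-Joins e∈ (inj₂ refl) u∈ v∈ = inj₂ refl , refl

  embed : C.Walk a b → Walk (value a) (value b)
  embed C.[]             = []
  embed (e C.∷⟨ j ⟩ p) = value e ∷⟨ forget-Joins e j ⟩ embed p

  edges-embed : (p : C.Walk a b) → edges (embed p) ≡ map value (C.edges p)
  edges-embed C.[]           = refl
  edges-embed (e C.∷⟨ _ ⟩ p) = cong (value e ∷_) (edges-embed p)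

  vertices-embed : (p : C.Walk a b) → vertices (embed p) ≡ map value (C.vertices p)
  vertices-embed C.[]               = refl
  vertices-embed {a} (_ C.∷⟨ _ ⟩ p) = cong (value a ∷_) (vertices-embed p)

  size-embed : (p : C.Walk a b) → size (embed p) ≡ C.size p
  size-embed p = trans (cong length (edges-embed p)) (length-map value (C.edges p))

  -- Decomposition of a trail along the core.

  Outside : Walk u v → Set
  Outside p = ∀ {e} → e ∈ edges p → ¬ InCore e

  outside-cons : {j : Joins e u v} {p : Walk v w} → ¬ InCore e → Outside p → Outside (e ∷⟨ j ⟩ p)
  outside-cons e∉ p-out (here refl)  = e∉
  outside-cons e∉ p-out (there f∈p) = p-out f∈p

  -- A later core edge would bring the trail back to the core, and the part up to there would be a
  -- trail between core vertices through `e`.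
  leave-core : u Subset.∈ V-C → {j : Joins e u v} (p : Walk v w) →
               IsTrail (e ∷⟨ j ⟩ p) → ¬ InCore e → Outside p
  leave-core {e = e} u∈ {j} p ep-trail e∉ {f} f∈p f∈ =
    let n , q , es , _ = prefix p (edge-end∈vertices p f∈p (inj₁ refl))
    in core-trail u∈ (proj₁ f∈) (e ∷⟨ j ⟩ q)
         (subst (Unique ∘ (e ∷_)) (sym es) (Unique.take⁺ (suc n) ep-trail))
         (here refl) e∉

  split-from-core : (u∈ : u Subset.∈ V-C) (p : Walk u v) → IsTrail p →
                    ∃[ b ] ∃ λ (q : C.Walk (u , [ u∈ ]) b) → ∃ λ (r : Walk (value b) v) →
                      p ≡ embed q ++ r × Outside r
  split-from-core u∈ [] _ = _ , C.[] , [] , refl , λ ()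
  split-from-core u∈ (e ∷⟨ j ⟩ p) ep-trail@(_ ∷ p-trail) with inCore? e
  ... | no e∉  = _ , C.[] , e ∷⟨ j ⟩ p , refl ,
                 outside-cons {j = j} {p} e∉ (leave-core u∈ {j} p ep-trail e∉)
  ... | yes e∈ with v∈ ← proj₂ (core-ends e∈ j)
      with b , q , r , refl , r-out ← split-from-core v∈ p p-trail
         | k , refl ← core-Joins e∈ j u∈ v∈
      = b , (e , [ e∈ ]) C.∷⟨ k ⟩ q , r , refl , r-out

  -- The middle part begins at the first core edge. A trail without core edges may miss `V-C`
  -- altogether and then offers no ends for `q`, hence the separate alternative.
  split : (p : Walk u v) → IsTrail p →
          Outside p ⊎
          ∃[ a ] ∃[ b ] ∃ λ (o : Walk u (value a)) → ∃ λ (q : C.Walk a b) →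
            ∃ λ (r : Walk (value b) v) → p ≡ o ++ embed q ++ r × Outside o × Outside r
  split [] _ = inj₁ λ ()
  split (e ∷⟨ j ⟩ p) ep-trail@(_ ∷ p-trail) with inCore? e
  ... | yes e∈ =
    let b , q , r , eq , r-out = split-from-core (proj₁ (core-ends e∈ j)) (e ∷⟨ j ⟩ p) ep-trail
    in inj₂ (_ , b , [] , q , r , eq , (λ ()) , r-out)
  ... | no e∉ with split p p-trail
  ...   | inj₁ p-out = inj₁ (outside-cons {j = j} {p} e∉ p-out)
  ...   | inj₂ (a , b , o , q , r , eq , o-out , r-out) =
    inj₂ (a , b , e ∷⟨ j ⟩ o , q , r , cong (e ∷⟨ j ⟩_) eq ,
          outside-cons {j = j} {o} e∉ o-out , r-out)

  -- Replacing `q` by a rival `q′` gives a walk that may meet itself; it is shortened to a path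
  -- before minimality is applied, and the sizes of `o` and `r` cancel.
  middle-shortest : (o : Walk u (value a)) (q : C.Walk a b) (r : Walk (value b) v) →
                    IsShortestPath (o ++ embed q ++ r) → C.IsShortestPath q
  middle-shortest o q r (path , minimal) =
    Unique.map⁻ (subst Unique (vertices-embed q) (++-pathˡ (embed q) (++-pathʳ o path))) ,
    λ q′ _ →
      let s , s-path , s≤ = shorten Fin._≟_ (o ++ embed q′ ++ r)
      in +-cancelʳ-≤ (size r) _ _ (+-cancelˡ-≤ (size o) _ _ (begin
           size o + (C.size q + size r)  ≡⟨ detour-size q ⟨
           size (o ++ embed q ++ r)      ≤⟨ minimal s s-path ⟩
           size s                        ≤⟨ s≤ ⟩
           size (o ++ embed q′ ++ r)     ≡⟨ detour-size q′ ⟩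
           size o + (C.size q′ + size r) ∎))
    where
    open ≤-Reasoning

    detour-size : (q : C.Walk _ _) →
                  size (o ++ embed q ++ r) ≡ size o + (C.size q + size r)
    detour-size q rewrite ++-size o (embed q ++ r) | ++-size (embed q) r | size-embed q = refl

  -- Traces of a shortest path in the core and in the periphery.

  core-part : Nonempty V-C → (p : Walk u v) → IsShortestPath p →
              ∃[ a ] ∃[ b ] ∃ λ (q : C.Walk a b) → C.IsShortestPath q ×
                (∀ {e} → e ∈ C.edges q → value e ∈ edges p) ×
                (∀ {e} → e ∈ edges p → (e∈ : InCore e) → (e , [ e∈ ]) ∈ C.edges q)
  core-part (x , x∈) p p-short with split p (path⇒trail p (proj₁ p-short))
  -- The trace is the path with no edges at an arbitrary core vertex, which need not lie on `p`.
  ... | inj₁ p-out = (x , [ x∈ ]) , _ , C.[] , ([] ∷ [] , λ _ _ → z≤n) , (λ ()) ,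
                     λ e∈p e∈ → contradiction e∈ (p-out e∈p)
  ... | inj₂ (a , b , o , q , r , refl , o-out , r-out) =
    a , b , q , middle-shortest o q r p-short ,
    (λ e∈q → subst (_ ∈_) (sym edges-p)
       (∈-++⁺ʳ (edges o) (∈-++⁺ˡ (∈-map⁺ value e∈q)))) ,
    λ e∈p e∈ → complete e∈ (subst (_ ∈_) edges-p e∈p)
    where
    edges-p : edges (o ++ embed q ++ r) ≡ edges o List.++ map value (C.edges q) List.++ edges r
    edges-p rewrite ++-edges o (embed q ++ r) | ++-edges (embed q) r | edges-embed q = refl

    complete : ∀ {e} (e∈ : InCore e) →
               e ∈ edges o List.++ map value (C.edges q) List.++ edges r → (e , [ e∈ ]) ∈ C.edges q
    complete e∈ e∈p with ∈-++⁻ (edges o) e∈p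
    ... | inj₁ e∈o = contradiction e∈ (o-out e∈o)
    ... | inj₂ e∈qr with ∈-++⁻ (map value (C.edges q)) e∈qr
    ...   | inj₂ e∈r = contradiction e∈ (r-out e∈r)
    -- Core edges with the same value are equal since their membership proofs are irrelevant.
    ...   | inj₁ e∈q with _ , f∈q , refl ← ∈-map⁻ value e∈q = f∈q

  periphery-part : (p : Walk u v) → IsPath p →
                   ∃ λ (q : P.Walk (contract u) (contract v)) → P.IsShortestPath q ×
                     (∀ {e} → e ∈ P.edges q → value e ∈ edges p) ×
                     (∀ {e} → e ∈ edges p → (e∉ : ¬ InCore e) → (e , [ e∉ ]) ∈ P.edges q)
  periphery-part p p-path =
    let q , eq = collapse p
    in q ,
       trail⇒shortest (Refinement._≟_ Fin._≟_) q (collapse-trail {p = p} (path⇒trail p p-path) q eq) ,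
       (λ e∈q → proj₁ (∈-filter⁻ (¬? ∘ inCore?) (subst (_ ∈_) eq (∈-map⁺ value e∈q)))) ,
       λ e∈p e∉ → complete q e∉ (subst (_ ∈_) (sym eq) (∈-filter⁺ (¬? ∘ inCore?) e∈p e∉))
    where
    complete : ∀ {u v} (q : P.Walk u v) {e} (e∉ : ¬ InCore e) →
               e ∈ map value (P.edges q) → (e , [ e∉ ]) ∈ P.edges q
    complete q e∉ e∈q with _ , f∈q , refl ← ∈-map⁻ value e∈q = f∈q

-- False positives of the combined labelling.

proposition3 : ∀ {a ℓ} (G : FiniteSimpleGraph) (V-C : Subset (#V G)) → Nonempty V-C →
    IsTree (periphery G V-C) →
    {U : Set a} {A B : Pred U ℓ} → A ⊥ B →
    (L-C : Labelling (core G V-C) A) (L-P : Labelling (periphery G V-C) B) →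
    NoFalsePositivesOnShortestPaths L-C →
    NoFalsePositivesOnShortestPaths L-P →
    NoFalsePositivesOnShortestPaths (combined G V-C L-C L-P)
proposition3 G V-C nonempty P-tree {A = A} {B} A⊥B L-C L-P L-C-ok L-P-ok p p-short (f , f∉p , f⊆p) =
  f∉periphery f∉core
  where
  open FiniteSimpleGraph G using (graph)
  open CorePeriphery G V-C using (InCore; inCore?)
  open Contraction G V-C P-tree
  open Graph graph using (edges; edgeSet)
  open Labelling

  L : Labelling graph (A ∪ B)
  L = combined G V-C L-C L-P

  -- An edge outside the core has its label in `B`, so by disjointness an element of `A` can only
  -- come from a core edge.
  labels-core : ∀ {x} → x ∈ᴾ labels L (edgeSet p) → x ∈ᴾ A →
                ∃ λ e → e ∈ edges p × ∃ λ (e∈ : InCore e) → x ∈ᴾ label L-C (e , [ e∈ ])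
  labels-core (e , e∈p , x∈e) x∈A with inCore? e
  ... | yes e∈ = e , e∈p , e∈ , x∈e
  ... | no e∉  = contradiction (x∈A , within L-P (e , [ e∉ ]) x∈e) A⊥B

  labels-periphery : ∀ {x} → x ∈ᴾ labels L (edgeSet p) → x ∈ᴾ B →
                     ∃ λ e → e ∈ edges p × ∃ λ (e∉ : ¬ InCore e) → x ∈ᴾ label L-P (e , [ e∉ ])
  labels-periphery (e , e∈p , x∈e) x∈B with inCore? e
  ... | yes e∈ = contradiction (within L-C (e , [ e∈ ]) x∈e , x∈B) A⊥B
  ... | no e∉  = e , e∈p , e∉ , x∈e

  label-core : ∀ {e x} (e∈ : InCore e) → x ∈ᴾ label L-C (e , [ e∈ ]) → x ∈ᴾ label L e
  label-core {e} e∈ x∈e with inCore? e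
  ... | yes _ = x∈e
  ... | no e∉ = contradiction e∈ e∉

  label-periphery : ∀ {e x} (e∉ : ¬ InCore e) → x ∈ᴾ label L-P (e , [ e∉ ]) → x ∈ᴾ label L e
  label-periphery {e} e∉ x∈e with inCore? e
  ... | yes e∈ = contradiction e∈ e∉
  ... | no _   = x∈e

  f∉core : ¬ InCore f
  f∉core f∈ =
    let _ , _ , q , q-short , sound , complete = core-part nonempty p p-short
    -- `sound` keeps `f` off `q`, and `complete` puts the core edge of `p` that supplies `x` on `q`.
    in L-C-ok q q-short ((f , [ f∈ ]) , f∉p ∘ sound , λ x∈f →
         let e , e∈p , e∈ , x∈e = labels-core (f⊆p (label-core f∈ x∈f)) (within L-C _ x∈f)
         in (e , [ e∈ ]) , complete e∈p e∈ , x∈e)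

  f∉periphery : ¬ ¬ InCore f
  f∉periphery f∉ =
    let q , q-short , sound , complete = periphery-part p (proj₁ p-short)
    in L-P-ok q q-short ((f , [ f∉ ]) , f∉p ∘ sound , λ x∈f →
         let e , e∈p , e∉ , x∈e = labels-periphery (f⊆p (label-periphery f∉ x∈f)) (within L-P _ x∈f)
         in (e , [ e∉ ]) , complete e∈p e∉ , x∈e)
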